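{- Let $m\ge 3$ and $n\ge 1$ be integers. The vertex residual closeness of the lollipop graph $L_{m,n}$ is $$VR(L_{m,n}) = \frac{(m-1)(m-2)}{2} + 2n + 2^{2-n} - 4 .$$
   Context: All graphs are finite, simple and undirected. The closeness of a graph $G$ is $C(G)=\sum_{i}\sum_{j\ne i}2^{ -d(i,j)}$, where $i,j$ range over the vertices of $G$ (ordered pairs), $d(i,j)$ is the distance between $i$ and $j$ in $G$, and the term $2^{ -d(i,j)}$ is $0$ if $i$ and $j$ lie in different connected components. The vertex residual closeness of $G$ is $VR(G)=\min_{r} C(G_r)$, where $r$ ranges over the vertices of $G$ and $G_r$ is the graph obtained from $G$ by removing the vertex $r$ together with all its links. The lollipop graph $L_{m,n}$ ($m\ge 3$, $n\ge 1$) has $m+n$ vertices $v_1,\dots,v_{m+n}$: the vertices $v_1,\dots,v_m$ form a complete graph $K_m$, the vertices $v_{m+1},\dots,v_{m+n}$ form a path $P_n$ (with links $(v_{m+i},v_{m+i+1})$, $1\le i\le n-1$), and there is one further link, the bridge $(v_m,v_{m+1})$. -}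

module Defs where

open import Algebra.Definitions.RawSemiring using (_^_)
import Algebra.Properties.CommutativeMonoid.Sum as Sum
open import Data.Bool.Base using (if_then_else_)
open import Data.Fin.Base using (Fin; zero; suc; toℕ; punchIn)
import Data.Fin.Properties as Fin
open import Data.Integer.Base as ℤ using (ℤ; +_; -[1+_])
open import Data.List.Base using (tabulate)
import Data.List.Extrema as Extrema
open import Data.Maybe.Base using (Maybe; just; nothing)
open import Data.Nat.Base
  using (ℕ; zero; suc; _+_; _∸_; _≤_; _<_; z≤n; s≤s; NonZero; >-nonZero)
open import Data.Nat.Induction using (<-rec)
import Data.Nat.Properties as ℕ
open import Data.Product.Base using (∃; _×_; _,_; proj₁; proj₂)
open import Data.Rational.Base as ℚ using (ℚ; 0ℚ; ½; _/_)
import Data.Rational.Properties as ℚ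
open import Data.Sum.Base using (_⊎_; inj₁; inj₂; swap)
open import Function.Base using (_∘_)
open import Level using (0ℓ)
open import Relation.Binary.Bundles using (DecTotalOrder)
open import Relation.Binary.Core using (Rel)
open import Relation.Binary.Definitions using (Decidable; Irreflexive; Symmetric)
open import Relation.Binary.PropositionalEquality
  using (_≡_; refl; sym; cong; subst)
open import Relation.Nullary using (¬_; Dec; yes; no; contradiction)
open import Relation.Nullary.Decidable
  using (_×-dec_; _⊎-dec_; map′; does)

open Sum ℚ.+-0-commutativeMonoid using (sum-syntax)
open Extrema (DecTotalOrder.totalOrder ℚ.≤-decTotalOrder) using (min)

record Graph (n : ℕ) : Set₁ where
  field
    Adj    : Rel (Fin n) 0ℓ
    adj?   : Decidable Adj
    symm   : Symmetric Adj
    irrefl : Irreflexive _≡_ Adj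

open Graph

data Walk {n} (G : Graph n) : ℕ → Fin n → Fin n → Set where
  []  : ∀ {i} → Walk G 0 i i
  _∷_ : ∀ {k i j l} → Adj G i j → Walk G k j l → Walk G (suc k) i l

-- `nothing` is the distance between vertices in different components.
IsDistance : ∀ {n} → Graph n → Fin n → Fin n → Maybe ℕ → Set
IsDistance G i j (just d) = Walk G d i j × (∀ {k} → k < d → ¬ Walk G k i j)
IsDistance G i j nothing  = ∀ {k} → ¬ Walk G k i j

module _ {n} (G : Graph n) where

  walk? : ∀ k i j → Dec (Walk G k i j)
  walk? zero i j = map′ (λ { refl → [] }) (λ { [] → refl }) (i Fin.≟ j)
  walk? (suc k) i j =
    map′ (λ { (_ , e , w) → e ∷ w }) (λ { (e ∷ w) → _ , e , w })
         (Fin.any? λ l → adj? G i l ×-dec walk? k l j)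

  vertex : ∀ {k i j} → Walk G k i j → Fin (suc k) → Fin n
  vertex {i = i} w zero = i
  vertex (e ∷ w) (suc a) = vertex w a

  take : ∀ {k i j} (w : Walk G k i j) a → Walk G (toℕ a) i (vertex w a)
  take w zero = []
  take (e ∷ w) (suc a) = e ∷ take w a

  drop : ∀ {k i j} (w : Walk G k i j) a → Walk G (k ∸ toℕ a) (vertex w a) j
  drop w zero = w
  drop (e ∷ w) (suc a) = drop w a

  _++_ : ∀ {k l i j h} → Walk G k i j → Walk G l j h → Walk G (k + l) i h
  []      ++ w′ = w′
  (e ∷ w) ++ w′ = e ∷ (w ++ w′)

  shorten : ∀ {k i j} → n ≤ k → Walk G k i j → ∃ λ l → l < k × Walk G l i j
  shorten {k} {i} {j} n≤k w with Fin.pigeonhole (s≤s n≤k) (vertex w)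
  ... | a , b , a<b , eq =
    toℕ a + (k ∸ toℕ b) , shorter ,
    (take w a ++ subst (λ v → Walk G (k ∸ toℕ b) v j) (sym eq) (drop w b))
    where
    shorter : toℕ a + (k ∸ toℕ b) < k
    shorter = subst (toℕ a + (k ∸ toℕ b) <_)
                    (ℕ.m+[n∸m]≡n (Fin.toℕ≤pred[n] b))
                    (ℕ.+-monoˡ-< (k ∸ toℕ b) a<b)

  shortest : ∀ {k i j} → Walk G k i j → ∃ λ d → IsDistance G i j (just d)
  shortest {k} {i} {j} =
    <-rec (λ k → Walk G k i j → ∃ λ d → IsDistance G i j (just d)) step k
    where
    step : ∀ k →
           (∀ {l} → l < k → Walk G l i j → ∃ λ d → IsDistance G i j (just d)) →
           Walk G k i j → ∃ λ d → IsDistance G i j (just d)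
    step k rec w with ℕ.anyUpTo? (λ l → walk? l i j) k
    ... | yes (l , l<k , w′) = rec l<k w′
    ... | no none            = k , w , λ l<k w′ → none (_ , l<k , w′)

  distance-exists : ∀ i j → ∃ (IsDistance G i j)
  distance-exists i j with ℕ.anyUpTo? (λ l → walk? l i j) n
  ... | yes (_ , _ , w) = just (proj₁ (shortest w)) , proj₂ (shortest w)
  ... | no none = nothing , λ w → noWalk (shortest w)
    where
    noWalk : ¬ (∃ λ d → IsDistance G i j (just d))
    noWalk (d , w , least) with d ℕ.<? n
    ... | yes d<n = none (d , d<n , w)
    ... | no d≮n with shorten (ℕ.≮⇒≥ d≮n) w
    ...   | _ , l<d , w′ = least l<d w′

  distance : Fin n → Fin n → Maybe ℕ
  distance i j = proj₁ (distance-exists i j)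

2^_ : ℤ → ℚ
2^ (+ k)    = _^_ ℚ.+-*-rawSemiring (+ 2 / 1) k
2^ -[1+ k ] = _^_ ℚ.+-*-rawSemiring ½ (suc k)

2^-_ : Maybe ℕ → ℚ
2^- just d  = 2^ (ℤ.- (+ d))
2^- nothing = 0ℚ

closeness : ∀ {n} → Graph n → ℚ
closeness {n} G =
  ∑[ i < n ] ∑[ j < n ]
    (if does (i Fin.≟ j) then 0ℚ else (2^- distance G i j))

-- `punchIn r` enumerates the vertices other than `r`.
remove : ∀ {n} → Graph (suc n) → Fin (suc n) → Graph n
remove G r = record
  { Adj    = λ i j → Adj G (punchIn r i) (punchIn r j)
  ; adj?   = λ i j → adj? G (punchIn r i) (punchIn r j)
  ; symm   = symm G
  ; irrefl = λ i≡j → irrefl G (cong (punchIn r) i≡j)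
  }

vertexResidualCloseness : ∀ {n} → Graph n → .{{NonZero n}} → ℚ
vertexResidualCloseness {suc n} G =
  min (closeness (remove G zero)) (tabulate λ r → closeness (remove G (suc r)))

-- Links (vₐ , v_b) with a < b of the lollipop graph.  The labels lie between
-- 1 and m + n, so the bounds 1 ≤ a and b ≤ m + n need not be imposed here.
data Link (m a b : ℕ) : Set where
  clique : a < b → b ≤ m → Link m a b
  bridge : a ≡ m → b ≡ suc m → Link m a b
  path   : m < a → b ≡ suc a → Link m a b

link? : ∀ m → Decidable (Link m)
link? m a b =
  map′ (λ { (inj₁ (p , q))        → clique p q
          ; (inj₂ (inj₁ (p , q))) → bridge p q
          ; (inj₂ (inj₂ (p , q))) → path p q })
       (λ { (clique p q) → inj₁ (p , q)
          ; (bridge p q) → inj₂ (inj₁ (p , q))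
          ; (path p q)   → inj₂ (inj₂ (p , q)) })
       ((a ℕ.<? b ×-dec b ℕ.≤? m) ⊎-dec
        ((a ℕ.≟ m ×-dec b ℕ.≟ suc m) ⊎-dec
         (m ℕ.<? a ×-dec b ℕ.≟ suc a)))

link⇒< : ∀ {m a b} → Link m a b → a < b
link⇒< (clique a<b _)     = a<b
link⇒< (bridge refl refl) = ℕ.n<1+n _
link⇒< (path _ refl)      = ℕ.n<1+n _

label : ∀ {n} → Fin n → ℕ
label i = suc (toℕ i)

lollipop : ∀ m n → Graph (m + n)
lollipop m n = record
  { Adj    = λ i j → Link m (label i) (label j) ⊎ Link m (label j) (label i)
  ; adj?   = λ i j → link? m (label i) (label j) ⊎-dec link? m (label j) (label i)
  ; symm   = swap
  ; irrefl = λ { refl (inj₁ e) → ℕ.<-irrefl refl (link⇒< e)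
               ; refl (inj₂ e) → ℕ.<-irrefl refl (link⇒< e) }
  }

lollipop-nonempty : ∀ m n → 3 ≤ m → NonZero (m + n)
lollipop-nonempty m n 3≤m =
  >-nonZero (ℕ.≤-trans (s≤s z≤n) (ℕ.≤-trans 3≤m (ℕ.m≤m+n m n)))

-- Order the vertices along the lollipop (the clique, then the path) and call the
-- sum of 2^-d(a,c) over a < c the column of c; the closeness is twice the sum of
-- the columns.  In a clique the column of c is c/2.  If c and c + 1 are adjacent,
-- column (c + 1) ≥ column c / 2 + 1/2, with equality if c is the only vertex of
-- {0,…,c} with a later neighbour.  So lower bounds on closeness only need links,
-- not distances.
--
-- Without the bridgehead v_m the columns are c/2 on K_{m-1} and 1 - 2^-j on P_n.
-- Removing another clique vertex can only increase these columns.  Removing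
-- v_{m+1+a} leaves columns ≥ 1 at v_m,…,v_{m+a}, because m - 1 ≥ 2 makes the first
-- of them ≥ 1 and the recurrence preserves this; the last columns restart at
-- 1 - 2^0, and the loss is compensated since the columns of P_n are all ≤ 1.

module Submission where

open import Defs
open import Algebra.Definitions.RawSemiring using (_^_)
import Algebra.Properties.CommutativeMonoid.Sum as Sum
open import Data.Bool.Base using (if_then_else_)
open import Data.Fin.Base using (Fin; zero; suc; toℕ; fromℕ<; punchIn)
import Data.Fin.Properties as Fin
open import Data.Integer.Base as ℤ using (+_)
import Data.Integer.Properties as ℤ
open import Data.List.Base using (List; tabulate)
import Data.List.Extrema as Extrema
import Data.List.Relation.Unary.All.Properties as All
open import Data.List.Relation.Unary.Any using (Any)
import Data.List.Relation.Unary.Any.Properties as Any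
open import Data.Maybe.Base using (just; nothing)
open import Data.Nat.Base as ℕ using (ℕ; zero; suc; _≤_; _<_; z≤n; s≤s)
import Data.Nat.Properties as ℕ
open import Data.Product.Base using (∃; _×_; _,_)
open import Data.Rational.Base as ℚ using (ℚ; 0ℚ; 1ℚ; ½; _/_; _+_; _-_; _*_)
import Data.Rational.Properties as ℚ
open import Data.Rational.Solver using (module +-*-Solver)
open import Data.Rational.Unnormalised.Base using (mkℚᵘ)
import Data.Rational.Unnormalised.Base as ℚᵘ
import Data.Rational.Unnormalised.Properties as ℚᵘ
open import Data.Sum.Base using (_⊎_; inj₁; inj₂)
open import Function.Base using (_∘_)
open import Relation.Binary.Bundles using (DecTotalOrder)
open import Relation.Binary.PropositionalEquality
import Relation.Binary.Reasoning.Setoid as SetoidReasoning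
open import Relation.Nullary using (¬_; yes; no; contradiction)
open import Relation.Nullary.Decidable using (does; from-yes; dec-true; dec-false)

open Sum ℚ.+-0-commutativeMonoid using (sum; sum-cong-≗)
open Extrema (DecTotalOrder.totalOrder ℚ.≤-decTotalOrder) using (min; v≤min⁺; min≤v⁺)
open Graph
open +-*-Solver

-- Finite sums over initial segments of the naturals.

2ℚ 4ℚ : ℚ
2ℚ = + 2 / 1
4ℚ = + 4 / 1

∑< : ℕ → (ℕ → ℚ) → ℚ
∑< zero    f = 0ℚ
∑< (suc n) f = ∑< n f + f n

∑<-cong : ∀ n {f g} → (∀ {a} → a < n → f a ≡ g a) → ∑< n f ≡ ∑< n g
∑<-cong zero    f≡g = refl
∑<-cong (suc n) f≡g =
  cong₂ _+_ (∑<-cong n (λ a<n → f≡g (ℕ.m<n⇒m<1+n a<n))) (f≡g (ℕ.n<1+n n))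

∑<-mono : ∀ n {f g} → (∀ {a} → a < n → f a ℚ.≤ g a) → ∑< n f ℚ.≤ ∑< n g
∑<-mono zero    f≤g = ℚ.≤-refl
∑<-mono (suc n) f≤g =
  ℚ.+-mono-≤ (∑<-mono n (λ a<n → f≤g (ℕ.m<n⇒m<1+n a<n))) (f≤g (ℕ.n<1+n n))

∑<-zero : ∀ n → ∑< n (λ _ → 0ℚ) ≡ 0ℚ
∑<-zero zero    = refl
∑<-zero (suc n) = trans (ℚ.+-identityʳ _) (∑<-zero n)

∑<-+ : ∀ n f g → ∑< n (λ a → f a + g a) ≡ ∑< n f + ∑< n g
∑<-+ zero    f g = refl
∑<-+ (suc n) f g = trans (cong (_+ (f n + g n)) (∑<-+ n f g))
  (solve 4 (λ a b c d → a :+ b :+ (c :+ d) := a :+ c :+ (b :+ d)) refl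
    (∑< n f) (∑< n g) (f n) (g n))

∑<-* : ∀ n q f → ∑< n (λ a → q * f a) ≡ q * ∑< n f
∑<-* zero    q f = sym (ℚ.*-zeroʳ q)
∑<-* (suc n) q f = trans (cong (_+ q * f n) (∑<-* n q f)) (sym (ℚ.*-distribˡ-+ q _ _))

∑<-split : ∀ m n f → ∑< (m ℕ.+ n) f ≡ ∑< m f + ∑< n (λ a → f (m ℕ.+ a))
∑<-split m zero    f rewrite ℕ.+-identityʳ m = sym (ℚ.+-identityʳ _)
∑<-split m (suc n) f rewrite ℕ.+-suc m n =
  trans (cong (_+ f (m ℕ.+ n)) (∑<-split m n f))
    (ℚ.+-assoc (∑< m f) (∑< n (λ a → f (m ℕ.+ a))) (f (m ℕ.+ n)))

sum-toℕ : ∀ n f → sum {n} (f ∘ toℕ) ≡ ∑< n f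
sum-toℕ zero    f = refl
sum-toℕ (suc n) f = trans (cong (λ x → f 0 + x) (sum-toℕ n (f ∘ suc)))
  (trans (cong (_+ ∑< n (f ∘ suc)) (sym (ℚ.+-identityˡ (f 0)))) (sym (∑<-split 1 n f)))

-- Enlarging the square by one adds a column, an equal row and a zero diagonal entry.
∑<-symmetric : ∀ n {f : ℕ → ℕ → ℚ} →
  (∀ {a} → a < n → f a a ≡ 0ℚ) →
  (∀ {a b} → a < n → b < n → f a b ≡ f b a) →
  ∑< n (λ a → ∑< n (f a)) ≡ 2ℚ * ∑< n (λ b → ∑< b (λ a → f a b))
∑<-symmetric zero    diag swap = refl
∑<-symmetric (suc n) {f} diag swap = begin
  ∑< n (λ a → ∑< n (f a) + f a n) + (∑< n (f n) + f n n)
    ≡⟨ cong₂ _+_ (∑<-+ n _ _)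
         (cong₂ _+_ (∑<-cong n λ a<n → swap (ℕ.n<1+n n) (ℕ.m<n⇒m<1+n a<n)) (diag (ℕ.n<1+n n))) ⟩
  ∑< n (λ a → ∑< n (f a)) + col + (col + 0ℚ)
    ≡⟨ cong (λ x → x + col + (col + 0ℚ))
         (∑<-symmetric n (diag ∘ ℕ.m<n⇒m<1+n)
           (λ a<n b<n → swap (ℕ.m<n⇒m<1+n a<n) (ℕ.m<n⇒m<1+n b<n))) ⟩
  2ℚ * rest + col + (col + 0ℚ)
    ≡⟨ solve 2 (λ x y → con 2ℚ :* x :+ y :+ (y :+ con 0ℚ) := con 2ℚ :* (x :+ y)) refl rest col ⟩
  2ℚ * (rest + col) ∎
  where
  open ≡-Reasoning
  col  = ∑< n (λ a → f a n)
  rest = ∑< n (λ b → ∑< b (λ a → f a b))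

-- Powers of one half and weights of pairs of vertices.

½^_ : ℕ → ℚ
½^ k = _^_ ℚ.+-*-rawSemiring ½ k

0≤½^ : ∀ k → 0ℚ ℚ.≤ ½^ k
0≤½^ zero    = from-yes (0ℚ ℚ.≤? 1ℚ)
0≤½^ (suc k) = ℚ.*-monoˡ-≤-nonNeg ½ (0≤½^ k)

½*≤ : ∀ {q} → 0ℚ ℚ.≤ q → ½ * q ℚ.≤ q
½*≤ {q} 0≤q = ℚ.≤-trans (ℚ.≤-reflexive (sym (ℚ.+-identityʳ (½ * q))))
  (ℚ.≤-trans (ℚ.+-monoʳ-≤ (½ * q) (ℚ.*-monoˡ-≤-nonNeg ½ 0≤q))
  (ℚ.≤-reflexive (solve 1 (λ q → con ½ :* q :+ con ½ :* q := q) refl q)))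

½^-anti : ∀ {k l} → k ≤ l → ½^ l ℚ.≤ ½^ k
½^-anti {l = zero}  z≤n = ℚ.≤-refl
½^-anti {l = suc l} z≤n = ℚ.≤-trans (½*≤ (0≤½^ l)) (½^-anti {l = l} z≤n)
½^-anti (s≤s k≤l) = ℚ.*-monoˡ-≤-nonNeg ½ (½^-anti k≤l)

2^-just : ∀ d → 2^- just d ≡ ½^ d
2^-just zero    = refl
2^-just (suc d) = refl

module _ {n} (G : Graph n) where

  weight : Fin n → Fin n → ℚ
  weight i j = if does (i Fin.≟ j) then 0ℚ else (2^- distance G i j)

  weight-diag : ∀ i → weight i i ≡ 0ℚ
  weight-diag i rewrite dec-true (i Fin.≟ i) refl = refl

  -- No walk is shorter than the distance, so any walk at hand gives a lower bound.
  walk⇒≤weight : ∀ {k i j} → i ≢ j → Walk G k i j → ½^ k ℚ.≤ weight i j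
  walk⇒≤weight {k} {i} {j} i≢j w
    rewrite dec-false (i Fin.≟ j) i≢j with distance-exists G i j
  ... | just d  , _ , least rewrite 2^-just d = ½^-anti (ℕ.≮⇒≥ λ k<d → least k<d w)
  ... | nothing , none  = contradiction w none

  -- A nonzero weight comes from a shortest walk, to which the bound applies; `0≤q` covers equal
  -- vertices and different components.
  weight≤ : ∀ {i j q} → 0ℚ ℚ.≤ q → (∀ {k} → Walk G k i j → ½^ k ℚ.≤ q) → weight i j ℚ.≤ q
  weight≤ {i} {j} 0≤q bound with i Fin.≟ j
  ... | yes _ = 0≤q
  ... | no  _ with distance-exists G i j
  ...   | just d  , w , _ rewrite 2^-just d = bound w
  ...   | nothing , _     = 0≤q

  0≤weight : ∀ i j → 0ℚ ℚ.≤ weight i j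
  0≤weight i j with i Fin.≟ j
  ... | yes _ = ℚ.≤-refl
  ... | no  _ with distance-exists G i j
  ...   | just d  , _ rewrite 2^-just d = 0≤½^ d
  ...   | nothing , _ = ℚ.≤-refl

  snoc : ∀ {k i j l} → Walk G k i j → Adj G j l → Walk G (suc k) i l
  snoc []      e′ = e′ ∷ []
  snoc (e ∷ w) e′ = e ∷ snoc w e′

  reverse : ∀ {k i j} → Walk G k i j → Walk G k j i
  reverse []      = []
  reverse (e ∷ w) = snoc (reverse w) (symm G e)

  weight-≤-sym : ∀ i j → weight i j ℚ.≤ weight j i
  weight-≤-sym i j with i Fin.≟ j
  ... | yes _   = 0≤weight j i
  ... | no i≢j with distance-exists G i j
  ...   | just d  , w , _ rewrite 2^-just d = walk⇒≤weight (i≢j ∘ sym) (reverse w)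
  ...   | nothing , _     = 0≤weight j i

  weight-sym : ∀ i j → weight i j ≡ weight j i
  weight-sym i j = ℚ.≤-antisym (weight-≤-sym i j) (weight-≤-sym j i)

  ½weight≤ : ∀ {i j l} → i ≢ l → Adj G j l → ½ * weight i j ℚ.≤ weight i l
  ½weight≤ {i} {j} {l} i≢l e = ℚ.≤-trans
    -- `weight≤` bounds a bare weight, so the factor ½ is moved to the other side as a 2.
    (ℚ.*-monoˡ-≤-nonNeg ½ (weight≤ {q = 2ℚ * weight i l} (ℚ.*-monoˡ-≤-nonNeg 2ℚ (0≤weight i l)) bound))
    (ℚ.≤-reflexive (solve 1 (λ x → con ½ :* (con 2ℚ :* x) := x) refl (weight i l)))
    where
    bound : ∀ {k} → Walk G k i j → ½^ k ℚ.≤ 2ℚ * weight i l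
    bound {k} w = ℚ.≤-trans
      (ℚ.≤-reflexive (solve 1 (λ x → x := con 2ℚ :* (con ½ :* x)) refl (½^ k)))
      (ℚ.*-monoˡ-≤-nonNeg 2ℚ (walk⇒≤weight i≢l (snoc w e)))

  weight≤½ : ∀ i j → weight i j ℚ.≤ ½
  weight≤½ i j with i Fin.≟ j
  ... | yes _   = from-yes (0ℚ ℚ.≤? ½)
  ... | no i≢j with distance-exists G i j
  ...   | nothing , _          = from-yes (0ℚ ℚ.≤? ½)
  ...   | just zero , [] , _   = contradiction refl i≢j
  ...   | just (suc d) , _     = ½^-anti {1} {suc d} (s≤s z≤n)

  -- Stops at the first link that leaves the initial segment; all upper bounds on distant weights
  -- come from this link.
  exit : ∀ {b k i j} → toℕ i < b → b ≤ toℕ j → Walk G k i j →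
         ∃ λ s → ∃ λ t → ∃ λ l →
           toℕ s < b × b ≤ toℕ t × Adj G s t × l < k × Walk G l i s
  exit i<b b≤i [] = contradiction i<b (ℕ.≤⇒≯ b≤i)
  exit {b} i<b b≤j (_∷_ {i = i} {j = l} e w) with toℕ l ℕ.<? b
  ... | no l≮b  = i , l , 0 , i<b , ℕ.≮⇒≥ l≮b , e , s≤s z≤n , []
  ... | yes l<b with exit l<b b≤j w
  ...   | s , t , k′ , s<b , b≤t , e′ , k′<k , w′ =
    s , t , suc k′ , s<b , b≤t , e′ , s≤s k′<k , (e ∷ w′)

-- Columns and their recurrence.

toℕ-elim : ∀ {n} {P : ℕ → Set} → (∀ (i : Fin n) → P (toℕ i)) → ∀ {a} → a < n → P a
toℕ-elim {P = P} p a<n = subst P (Fin.toℕ-fromℕ< a<n) (p (fromℕ< a<n))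

-- Extension by 0 lets sums be indexed and split over ℕ, without casts between `Fin` types.
pad : ∀ {n} → (Fin n → ℚ) → ℕ → ℚ
pad {zero}  f a       = 0ℚ
pad {suc n} f zero    = f zero
pad {suc n} f (suc a) = pad (f ∘ suc) a

pad-toℕ : ∀ {n} (f : Fin n → ℚ) i → pad f (toℕ i) ≡ f i
pad-toℕ f zero    = refl
pad-toℕ f (suc i) = pad-toℕ (f ∘ suc) i

Clique : ∀ {n} → Graph n → ℕ → Set
Clique G k = ∀ {i j} → toℕ i < toℕ j → toℕ j < k → Adj G i j

Path : ∀ {n} → Graph n → ℕ → ℕ → Set
Path G c k = ∀ {i j} → c ≤ toℕ i → toℕ j ≡ suc (toℕ i) → toℕ j < c ℕ.+ k → Adj G i j

Separated : ∀ {n} → Graph n → ℕ → Set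
Separated G b = ∀ {i j} → toℕ i < b → b ≤ toℕ j → ¬ Adj G i j

Cut : ∀ {n} → Graph n → ℕ → Set
Cut G c = ∀ {i j} → toℕ i ≤ c → c < toℕ j → Adj G i j → toℕ i ≡ c

-- The value c/2, kept as a sum so that it can be compared with a column termwise.
cliqueSum : ℕ → ℚ
cliqueSum c = ∑< c (λ _ → ½)

module _ {n} (G : Graph n) where

  ω : ℕ → ℕ → ℚ
  ω a b = pad (λ i → pad (weight G i) b) a

  ω-toℕ : ∀ i j → ω (toℕ i) (toℕ j) ≡ weight G i j
  ω-toℕ i j = trans (pad-toℕ _ i) (pad-toℕ (weight G i) j)

  column : ℕ → ℚ
  column c = ∑< c (λ a → ω a c)

  closeness≡columns : closeness G ≡ 2ℚ * ∑< n column
  closeness≡columns = begin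
    sum {n} (λ i → sum {n} (weight G i))
      ≡⟨ sum-cong-≗ {n} (λ i → trans (sum-cong-≗ {n} (λ j → sym (ω-toℕ i j))) (sum-toℕ n (ω (toℕ i)))) ⟩
    sum {n} (λ i → ∑< n (ω (toℕ i)))
      ≡⟨ sum-toℕ n (λ a → ∑< n (ω a)) ⟩
    ∑< n (λ a → ∑< n (ω a))
      ≡⟨ ∑<-symmetric n
           (toℕ-elim {n} {λ a → ω a a ≡ 0ℚ} λ i → trans (ω-toℕ i i) (weight-diag G i))
           (λ a<n b<n → toℕ-elim {n} {λ a → ω a _ ≡ ω _ a} (λ i →
             toℕ-elim {n} {λ b → ω (toℕ i) b ≡ ω b (toℕ i)} (λ j →
               trans (ω-toℕ i j) (trans (weight-sym G i j) (sym (ω-toℕ j i)))) b<n) a<n) ⟩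
    2ℚ * ∑< n column ∎
    where open ≡-Reasoning

  column-mono : ∀ {c} {f : ℕ → ℚ} → c < n →
    (∀ {i j} → toℕ i < c → toℕ j ≡ c → f (toℕ i) ℚ.≤ weight G i j) →
    ∑< c f ℚ.≤ column c
  column-mono {c} {f} c<n f≤ = ∑<-mono c λ a<c →
    toℕ-elim {n} {λ a → a < c → f a ℚ.≤ ω a c}
      (λ i i<c → toℕ-elim {n} {λ b → b ≡ c → f (toℕ i) ℚ.≤ ω (toℕ i) b}
        (λ j j≡c → ℚ.≤-trans (f≤ i<c j≡c) (ℚ.≤-reflexive (sym (ω-toℕ i j)))) c<n refl)
      (ℕ.<-trans a<c c<n) a<c

  column-anti : ∀ {c} {f : ℕ → ℚ} → c < n →
    (∀ {i j} → toℕ i < c → toℕ j ≡ c → weight G i j ℚ.≤ f (toℕ i)) →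
    column c ℚ.≤ ∑< c f
  column-anti {c} {f} c<n ≤f = ∑<-mono c λ a<c →
    toℕ-elim {n} {λ a → a < c → ω a c ℚ.≤ f a}
      (λ i i<c → toℕ-elim {n} {λ b → b ≡ c → ω (toℕ i) b ℚ.≤ f (toℕ i)}
        (λ j j≡c → ℚ.≤-trans (ℚ.≤-reflexive (ω-toℕ i j)) (≤f i<c j≡c)) c<n refl)
      (ℕ.<-trans a<c c<n) a<c

  0≤column : ∀ {c} → c < n → 0ℚ ℚ.≤ column c
  0≤column {c} c<n = subst (ℚ._≤ column c) (∑<-zero c)
    (column-mono c<n λ {i} {j} _ _ → 0≤weight G i j)

  column≤cliqueSum : ∀ {c} → c < n → column c ℚ.≤ cliqueSum c
  column≤cliqueSum c<n = column-anti c<n λ {i} {j} _ _ → weight≤½ G i j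

  clique⇒column≥ : ∀ {k c} → Clique G k → c < k → c < n → cliqueSum c ℚ.≤ column c
  clique⇒column≥ adj c<k c<n = column-mono c<n λ { i<c refl →
    walk⇒≤weight G (λ { refl → ℕ.<-irrefl refl i<c }) (adj i<c c<k ∷ []) }

  -- A walk from below c to c would have to cross, so there is none and each weight is bounded by 0.
  separated⇒column≤ : ∀ {c} → Separated G c → c < n → column c ℚ.≤ 0ℚ
  separated⇒column≤ {c} sep c<n = subst (column c ℚ.≤_) (∑<-zero c)
    (column-anti c<n λ { i<c refl → weight≤ G ℚ.≤-refl λ w →
      let (_ , _ , _ , s<c , c≤t , e , _) = exit G i<c ℕ.≤-refl w
      in contradiction e (sep s<c c≤t) })

  private
    -- The right side of the recurrence, spread over the entries of the next column: earlier
    -- vertices pay one more link after c, and c itself is one link away.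
    pathStep : ℕ → ℕ → ℚ
    pathStep c a = if does (a ℕ.<? c) then ½ * ω a c else ½

    pathStep-< : ∀ {a c} → a < c → pathStep c a ≡ ½ * ω a c
    pathStep-< {a} {c} a<c rewrite dec-true (a ℕ.<? c) a<c = refl

    pathStep-≡ : ∀ {a c} → a ≡ c → pathStep c a ≡ ½
    pathStep-≡ {a} {c} a≡c rewrite dec-false (a ℕ.<? c) (ℕ.<-irrefl a≡c) = refl

    ∑<-pathStep : ∀ c → ∑< (suc c) (pathStep c) ≡ ½ * column c + ½
    ∑<-pathStep c = cong₂ _+_
      (trans (∑<-cong c pathStep-<) (∑<-* c ½ (λ a → ω a c)))
      (pathStep-≡ {c} refl)

  -- Every walk to c extends by the link to c + 1, which costs at most a factor ½.
  adjacent⇒column≥ : ∀ {c} → (∀ {i j} → toℕ i ≡ c → toℕ j ≡ suc c → Adj G i j) →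
    suc c < n → ½ * column c + ½ ℚ.≤ column (suc c)
  adjacent⇒column≥ {c} adj c+1<n = subst (ℚ._≤ column (suc c)) (∑<-pathStep c)
    (column-mono c+1<n step)
    where
    step : ∀ {i j} → toℕ i < suc c → toℕ j ≡ suc c → pathStep c (toℕ i) ℚ.≤ weight G i j
    step {i} {j} i≤c j≡ with ℕ.m<1+n⇒m<n∨m≡n i≤c
    ... | inj₁ i<c = subst (ℚ._≤ weight G i j) (sym (pathStep-< i<c))
      (toℕ-elim {n} {λ a → a ≡ c → ½ * ω (toℕ i) a ℚ.≤ weight G i j}
        (λ l l≡c → subst (λ x → ½ * x ℚ.≤ weight G i j) (sym (ω-toℕ i l))
          (½weight≤ G (λ { refl → ℕ.<-irrefl j≡ i≤c }) (adj l≡c j≡)))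
        (ℕ.<-trans (ℕ.n<1+n c) c+1<n) refl)
    ... | inj₂ i≡c = subst (ℚ._≤ weight G i j) (sym (pathStep-≡ i≡c))
      (walk⇒≤weight G (λ { refl → ℕ.<-irrefl j≡ i≤c }) (adj i≡c j≡ ∷ []))

  cut⇒column≤ : ∀ {c} → Cut G c → suc c < n → column (suc c) ℚ.≤ ½ * column c + ½
  cut⇒column≤ {c} cut c+1<n = subst (column (suc c) ℚ.≤_) (∑<-pathStep c)
    (column-anti c+1<n step)
    where
    -- A walk into c + 1 has to leave {0,…,c} through c.
    shorter : ∀ {i j l k} → toℕ i < c → toℕ l ≡ c → toℕ j ≡ suc c →
              Walk G k i j → ½^ k ℚ.≤ ½ * weight G i l
    shorter i<c l≡c j≡ w
      with exit G (ℕ.m<n⇒m<1+n i<c) (ℕ.≤-reflexive (sym j≡)) w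
    ... | s , t , _ , s≤c , c<t , e , k′<k , w′
      with Fin.toℕ-injective (trans (cut (ℕ.s≤s⁻¹ s≤c) c<t e) (sym l≡c))
    ...   | refl = ℚ.≤-trans (½^-anti k′<k) (ℚ.*-monoˡ-≤-nonNeg ½
      (walk⇒≤weight G (λ { refl → ℕ.<-irrefl l≡c i<c }) w′))

    step : ∀ {i j} → toℕ i < suc c → toℕ j ≡ suc c → weight G i j ℚ.≤ pathStep c (toℕ i)
    step {i} {j} i≤c j≡ with ℕ.m<1+n⇒m<n∨m≡n i≤c
    ... | inj₁ i<c = subst (weight G i j ℚ.≤_) (sym (pathStep-< i<c))
      (toℕ-elim {n} {λ a → a ≡ c → weight G i j ℚ.≤ ½ * ω (toℕ i) a}
        (λ l l≡c → subst (λ x → weight G i j ℚ.≤ ½ * x) (sym (ω-toℕ i l))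
          (weight≤ G (ℚ.*-monoˡ-≤-nonNeg ½ (0≤weight G i l)) (shorter i<c l≡c j≡)))
        (ℕ.<-trans (ℕ.n<1+n c) c+1<n) refl)
    ... | inj₂ i≡c = subst (weight G i j ℚ.≤_) (sym (pathStep-≡ i≡c)) (weight≤½ G i j)

  -- Stated for any solution f of the recurrence: it serves both for `pathColumn` and for the fixed
  -- point 1.
  path⇒columns≥ : ∀ {c k} {f : ℕ → ℚ} → Path G c k → c ℕ.+ k ≤ n →
    f 0 ℚ.≤ column c → (∀ j → f (suc j) ≡ ½ * f j + ½) →
    ∀ {j} → j < k → f j ℚ.≤ column (c ℕ.+ j)
  path⇒columns≥ {c} _ _ base _ {zero} _ rewrite ℕ.+-identityʳ c = base
  path⇒columns≥ {c} {k} {f} adj bound base rec {suc j} j<k rewrite rec j | ℕ.+-suc c j =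
    ℚ.≤-trans
      (ℚ.+-monoˡ-≤ ½ (ℚ.*-monoˡ-≤-nonNeg ½
        (path⇒columns≥ {f = f} adj bound base rec (ℕ.<-trans (ℕ.n<1+n j) j<k))))
      (adjacent⇒column≥
        (λ i≡ j≡ → adj (subst (c ≤_) (sym i≡) (ℕ.m≤m+n c j)) (trans j≡ (cong suc (sym i≡)))
                        (subst (_< c ℕ.+ k) (sym j≡) c+j<))
        (ℕ.≤-trans c+j< bound))
    where
    c+j< : suc (c ℕ.+ j) < c ℕ.+ k
    c+j< = subst (_< c ℕ.+ k) (ℕ.+-suc c j) (ℕ.+-monoʳ-< c j<k)

  cuts⇒columns≤ : ∀ {c k} {f : ℕ → ℚ} → (∀ {b} → c ≤ b → Cut G b) → c ℕ.+ k ≤ n →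
    column c ℚ.≤ f 0 → (∀ j → f (suc j) ≡ ½ * f j + ½) →
    ∀ {j} → j < k → column (c ℕ.+ j) ℚ.≤ f j
  cuts⇒columns≤ {c} _ _ base _ {zero} _ rewrite ℕ.+-identityʳ c = base
  cuts⇒columns≤ {c} {k} {f} cut bound base rec {suc j} j<k rewrite rec j | ℕ.+-suc c j =
    ℚ.≤-trans
      (cut⇒column≤ (cut (ℕ.m≤m+n c j)) (ℕ.≤-trans c+j< bound))
      (ℚ.+-monoˡ-≤ ½ (ℚ.*-monoˡ-≤-nonNeg ½
        (cuts⇒columns≤ {f = f} cut bound base rec (ℕ.<-trans (ℕ.n<1+n j) j<k))))
    where
    c+j< : suc (c ℕ.+ j) < c ℕ.+ k
    c+j< = subst (_< c ℕ.+ k) (ℕ.+-suc c j) (ℕ.+-monoʳ-< c j<k)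

-- Links of the lollipop after a removal.

punchIn-< : ∀ {n} (r : Fin (suc n)) (i : Fin n) → toℕ i < toℕ r → toℕ (punchIn r i) ≡ toℕ i
punchIn-< (suc r) zero    _         = refl
punchIn-< (suc r) (suc i) (s≤s i<r) = cong suc (punchIn-< r i i<r)

punchIn-≥ : ∀ {n} (r : Fin (suc n)) (i : Fin n) → toℕ r ≤ toℕ i → toℕ (punchIn r i) ≡ suc (toℕ i)
punchIn-≥ zero    i       _         = refl
punchIn-≥ (suc r) (suc i) (s≤s r≤i) = cong suc (punchIn-≥ r i r≤i)

punchIn-≤suc : ∀ {n} (r : Fin (suc n)) (i : Fin n) → toℕ (punchIn r i) ≤ suc (toℕ i)
punchIn-≤suc r i with toℕ i ℕ.<? toℕ r
... | yes i<r = ℕ.≤-trans (ℕ.≤-reflexive (punchIn-< r i i<r)) (ℕ.n≤1+n _)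
... | no i≮r  = ℕ.≤-reflexive (punchIn-≥ r i (ℕ.≮⇒≥ i≮r))

punchIn-mono-< : ∀ {n} (r : Fin (suc n)) (i j : Fin n) → toℕ i < toℕ j →
                 toℕ (punchIn r i) < toℕ (punchIn r j)
punchIn-mono-< r i j i<j = ℕ.≤∧≢⇒< (Fin.punchIn-mono-≤ r i j (ℕ.<⇒≤ i<j)) λ eq →
  ℕ.<-irrefl (cong toℕ (Fin.punchIn-injective r i j (Fin.toℕ-injective eq))) i<j

-- Bridge and path links are treated alike, as steps from a to a + 1 with m ≤ a.
link-suc : ∀ {m a} → m ≤ a → Link (suc m) (suc a) (suc (suc a))
link-suc m≤a with ℕ.m≤n⇒m<n∨m≡n m≤a
... | inj₁ m<a  = path (s≤s m<a) refl
... | inj₂ refl = bridge refl refl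

link⇒ : ∀ {m a b} → Link (suc m) (suc a) (suc b) → b ≤ m ⊎ (m ≤ a × b ≡ suc a)
link⇒ (clique _ b≤m)      = inj₁ (ℕ.s≤s⁻¹ b≤m)
link⇒ (bridge refl refl)  = inj₂ (ℕ.≤-refl , refl)
link⇒ (path m<a refl)     = inj₂ (ℕ.<⇒≤ (ℕ.s≤s⁻¹ m<a) , refl)

-- Vertices are counted from 0, so the bridge of the lollipop starts at m.
-- In G the vertices after r move down by one.
module _ (m n : ℕ) (r : Fin (suc m ℕ.+ n)) where

  private
    G : Graph (m ℕ.+ n)
    G = remove (lollipop (suc m) n) r

  -- Indices grow by at most one, so those below m come from the m + 1 clique vertices, whichever
  -- vertex is removed.
  remove-clique : Clique G m
  remove-clique {i} {j} i<j j<m = inj₁ (clique (s≤s (punchIn-mono-< r i j i<j))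
    (s≤s (ℕ.≤-trans (punchIn-≤suc r j) j<m)))

  -- The whole clique lies before r and keeps its indices, the bridgehead m included.
  remove-clique-far : m < toℕ r → Clique G (suc m)
  remove-clique-far m<r {i} {j} i<j j≤m = inj₁ (clique (s≤s (punchIn-mono-< r i j i<j))
    (subst (_≤ suc m) (cong suc (sym (punchIn-< r j (ℕ.<-≤-trans j≤m m<r)))) j≤m))

  remove-path-before : ∀ {k} → m ℕ.+ k ≤ toℕ r → Path G m k
  remove-path-before {k} m+k≤r {i} {j} m≤i j≡ j<m+k = inj₁
    (subst₂ (λ a b → Link (suc m) (suc a) (suc b))
      (sym (punchIn-< r i (ℕ.<-trans i<j j<r)))
      (sym (trans (punchIn-< r j j<r) j≡))
      (link-suc m≤i))
    where
    j<r : toℕ j < toℕ r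
    j<r = ℕ.<-≤-trans j<m+k m+k≤r
    i<j : toℕ i < toℕ j
    i<j = ℕ.≤-reflexive (sym j≡)

  remove-path-after : ∀ {c k} → m ≤ c → toℕ r ≤ c → Path G c k
  remove-path-after m≤c r≤c {i} {j} c≤i j≡ _ = inj₁
    (subst₂ (λ a b → Link (suc m) (suc a) (suc b))
      (sym (punchIn-≥ r i r≤i))
      (sym (trans (punchIn-≥ r j (ℕ.≤-trans r≤i (subst (toℕ i ≤_) (sym j≡) (ℕ.n≤1+n _))))
                  (cong suc j≡)))
      (link-suc (ℕ.≤-trans m≤c (ℕ.m≤n⇒m≤1+n c≤i))))
    where
    r≤i : toℕ r ≤ toℕ i
    r≤i = ℕ.≤-trans r≤c c≤i

  upward : ∀ {i j} → toℕ i < toℕ j → Adj G i j →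
           Link (suc m) (label (punchIn r i)) (label (punchIn r j))
  upward i<j         (inj₁ l) = l
  upward {i} {j} i<j (inj₂ l) =
    contradiction (punchIn-mono-< r i j i<j) (ℕ.<-asym (ℕ.s≤s⁻¹ (link⇒< l)))

  module _ (r≡m : toℕ r ≡ m) where

    remove-separated : Separated G m
    remove-separated {i} {j} i<m m≤j e
      with link⇒ (subst₂ (λ a b → Link (suc m) (suc a) (suc b))
             (punchIn-< r i (subst (toℕ i <_) (sym r≡m) i<m))
             (punchIn-≥ r j (subst (_≤ toℕ j) (sym r≡m) m≤j))
             (upward (ℕ.<-≤-trans i<m m≤j) e))
    -- Index j stands for the old index j + 1, so a clique link would force j < m; any other link
    -- starts at m or later.
    ... | inj₁ j<m       = ℕ.<⇒≱ j<m m≤j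
    ... | inj₂ (m≤i , _) = ℕ.<⇒≱ i<m m≤i

    remove-cut : ∀ {c} → m ≤ c → Cut G c
    remove-cut {c} m≤c {i} {j} i≤c c<j e with toℕ i ℕ.<? m
    ... | yes i<m = contradiction e (remove-separated i<m (ℕ.≤-trans m≤c (ℕ.<⇒≤ c<j)))
    ... | no i≮m
      with link⇒ (subst₂ (λ a b → Link (suc m) (suc a) (suc b))
             (punchIn-≥ r i (subst (_≤ toℕ i) (sym r≡m) (ℕ.≮⇒≥ i≮m)))
             (punchIn-≥ r j (subst (_≤ toℕ j) (sym r≡m) (ℕ.≤-trans m≤c (ℕ.<⇒≤ c<j))))
             (upward (ℕ.≤-<-trans i≤c c<j) e))
    ... | inj₁ j<m       = contradiction (ℕ.<-trans (ℕ.≤-<-trans m≤c c<j) j<m) (ℕ.<-irrefl refl)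
    -- The link is a single step, so it can pass c only by starting at c.
    ... | inj₂ (_ , j≡)  =
      ℕ.≤-antisym i≤c (ℕ.s≤s⁻¹ (subst (c <_) (ℕ.suc-injective j≡) c<j))

-- Closeness after each removal, and the minimum.

pathColumn : ℕ → ℚ
pathColumn j = 1ℚ - ½^ j

pathColumn-suc : ∀ j → pathColumn (suc j) ≡ ½ * pathColumn j + ½
pathColumn-suc j = solve 1
  (λ x → con 1ℚ :- con ½ :* x := con ½ :* (con 1ℚ :- x) :+ con ½) refl (½^ j)

pathColumn≤1 : ∀ j → pathColumn j ℚ.≤ 1ℚ
pathColumn≤1 j = ℚ.≤-trans (ℚ.+-monoʳ-≤ 1ℚ (ℚ.neg-antimono-≤ (0≤½^ j)))
  (ℚ.≤-reflexive (ℚ.+-identityʳ 1ℚ))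

cliqueTotal pathTotal : ℕ → ℚ
cliqueTotal m = ∑< m cliqueSum
pathTotal n = ∑< n pathColumn

-- Only the last k terms are replaced by 1. This is the compensation when a path vertex is removed.
pathTotal-+ : ∀ k n → pathTotal (k ℕ.+ n) ℚ.≤ ∑< k (λ _ → 1ℚ) + pathTotal n
pathTotal-+ k n rewrite ℕ.+-comm k n | ∑<-split n k pathColumn =
  ℚ.≤-trans (ℚ.+-monoʳ-≤ (pathTotal n) (∑<-mono k λ {j} _ → pathColumn≤1 (n ℕ.+ j)))
    (ℚ.≤-reflexive (ℚ.+-comm (pathTotal n) _))

-- Two halves already give 1. Here the theorem's bound on the clique size enters, with m one less
-- than there.
1≤cliqueSum : ∀ {m} → 2 ≤ m → 1ℚ ℚ.≤ cliqueSum m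
1≤cliqueSum {suc zero} (s≤s ())
1≤cliqueSum {suc (suc m)} _ = ℚ.≤-trans
  (ℚ.+-monoˡ-≤ ½ (ℚ.+-monoˡ-≤ ½ {0ℚ} {cliqueSum m}
    (subst (ℚ._≤ cliqueSum m) (∑<-zero m) (∑<-mono m λ _ → from-yes (0ℚ ℚ.≤? ½)))))
  ℚ.≤-refl

-- The closeness of the disjoint union of a clique on m vertices and a path on n, which is what
-- remains of `lollipop (suc m) n` without its bridgehead.
total : ℕ → ℕ → ℚ
total m n = 2ℚ * (cliqueTotal m + pathTotal n)

closeness-split : ∀ m n (G : Graph (m ℕ.+ n)) →
  closeness G ≡ 2ℚ * (∑< m (column G) + ∑< n (λ j → column G (m ℕ.+ j)))
closeness-split m n G = trans (closeness≡columns G) (cong (2ℚ *_) (∑<-split m n (column G)))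

remove-near≥ : ∀ m n (r : Fin (suc m ℕ.+ n)) → 1 ≤ n → toℕ r ≤ m →
  total m n ℚ.≤ closeness (remove (lollipop (suc m) n) r)
remove-near≥ m n r 1≤n r≤m rewrite closeness-split m n (remove (lollipop (suc m) n) r) =
  ℚ.*-monoˡ-≤-nonNeg 2ℚ (ℚ.+-mono-≤
    (∑<-mono m λ c<m → clique⇒column≥ G (remove-clique m n r) c<m
      (ℕ.<-≤-trans c<m (ℕ.m≤m+n m n)))
    (∑<-mono n (path⇒columns≥ G {f = pathColumn} (remove-path-after m n r ℕ.≤-refl r≤m) ℕ.≤-refl
      -- `pathColumn 0` is 0, so nothing is claimed about links between clique and path.
      (0≤column G (ℕ.m<m+n m 1≤n)) pathColumn-suc)))
  where G = remove (lollipop (suc m) n) r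

remove-bridge≤ : ∀ m n (r : Fin (suc m ℕ.+ n)) → 1 ≤ n → toℕ r ≡ m →
  closeness (remove (lollipop (suc m) n) r) ℚ.≤ total m n
remove-bridge≤ m n r 1≤n r≡m rewrite closeness-split m n (remove (lollipop (suc m) n) r) =
  ℚ.*-monoˡ-≤-nonNeg 2ℚ (ℚ.+-mono-≤
    (∑<-mono m λ c<m → column≤cliqueSum G (ℕ.<-≤-trans c<m (ℕ.m≤m+n m n)))
    (∑<-mono n (cuts⇒columns≤ G {f = pathColumn} (remove-cut m n r r≡m) ℕ.≤-refl
      (separated⇒column≤ G (remove-separated m n r r≡m) (ℕ.m<m+n m 1≤n)) pathColumn-suc)))
  where G = remove (lollipop (suc m) n) r

-- The sum splits at r: the bridgehead and a path vertices come before it, b path vertices after it.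
remove-far≥ : ∀ m a b (r : Fin (suc m ℕ.+ (suc a ℕ.+ b))) → 2 ≤ m → toℕ r ≡ m ℕ.+ suc a →
  total m (suc a ℕ.+ b) ℚ.≤ closeness (remove (lollipop (suc m) (suc a ℕ.+ b)) r)
remove-far≥ m a b r 2≤m r≡
  rewrite closeness-split m (suc a ℕ.+ b) (remove (lollipop (suc m) (suc a ℕ.+ b)) r) =
  ℚ.*-monoˡ-≤-nonNeg 2ℚ (ℚ.+-mono-≤
    (∑<-mono m λ c<m → clique⇒column≥ G (remove-clique m n r) c<m (ℕ.<-≤-trans c<m (ℕ.m≤m+n m n)))
    (ℚ.≤-trans (pathTotal-+ (suc a) b)
      (ℚ.≤-trans (ℚ.+-mono-≤ (∑<-mono (suc a) before) (∑<-mono b after))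
        (ℚ.≤-reflexive (sym (∑<-split (suc a) b (λ j → column G (m ℕ.+ j))))))))
  where
  n = suc a ℕ.+ b
  G = remove (lollipop (suc m) n) r
  bound : (m ℕ.+ suc a) ℕ.+ b ≤ m ℕ.+ n
  bound = ℕ.≤-reflexive (ℕ.+-assoc m (suc a) b)
  m<r : m < toℕ r
  m<r = subst (m <_) (sym r≡) (ℕ.m<m+n m (s≤s z≤n))
  before : ∀ {j} → j < suc a → 1ℚ ℚ.≤ column G (m ℕ.+ j)
  before = path⇒columns≥ G {f = λ _ → 1ℚ} (remove-path-before m n r (ℕ.≤-reflexive (sym r≡)))
    (ℕ.≤-trans (ℕ.m≤m+n _ b) bound)
    (ℚ.≤-trans (1≤cliqueSum 2≤m)
      (clique⇒column≥ G (remove-clique-far m n r m<r) ℕ.≤-refl (ℕ.m<m+n m (s≤s z≤n))))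
    (λ _ → refl)
  after : ∀ {j} → j < b → pathColumn j ℚ.≤ column G (m ℕ.+ (suc a ℕ.+ j))
  after {j} j<b = subst (λ c → pathColumn j ℚ.≤ column G c) (ℕ.+-assoc m (suc a) j)
    (path⇒columns≥ G {f = pathColumn}
      (remove-path-after m n r (ℕ.m≤m+n m (suc a)) (ℕ.≤-reflexive r≡)) bound
      -- That b is positive, hence that this column exists, follows from j < b.
      (0≤column G (ℕ.<-≤-trans (ℕ.m<m+n _ (ℕ.≤-<-trans z≤n j<b)) bound)) pathColumn-suc j<b)

remove≥ : ∀ m n (r : Fin (suc m ℕ.+ n)) → 2 ≤ m → 1 ≤ n →
  total m n ℚ.≤ closeness (remove (lollipop (suc m) n) r)
remove≥ m n r 2≤m 1≤n with toℕ r ℕ.≤? m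
... | yes r≤m = remove-near≥ m n r 1≤n r≤m
... | no r≰m with ℕ.m≤n⇒∃[o]m+o≡n (ℕ.≰⇒> r≰m)
...   | a , eq
  -- Now r is m + 1 + a, and r < m + 1 + n gives a < n.
  with ℕ.m≤n⇒∃[o]m+o≡n {suc a} {n}
         (ℕ.+-cancelˡ-< (suc m) a n (subst (_< suc m ℕ.+ n) (sym eq) (Fin.toℕ<n r)))
...     | b , refl = remove-far≥ m a b r 2≤m (trans (sym eq) (sym (ℕ.+-suc m a)))

-- An upper bound at one vertex suffices, since the lower bound holds at all of them.
vertexResidualCloseness≡ : ∀ {n} (G : Graph (suc n)) {q} r →
  closeness (remove G r) ℚ.≤ q → (∀ r → q ℚ.≤ closeness (remove G r)) →
  vertexResidualCloseness G ≡ q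
vertexResidualCloseness≡ G {q} r attained bound = ℚ.≤-antisym
  (min≤v⁺ (closeness (remove G zero)) others (position r attained))
  (v≤min⁺ (bound zero) (All.tabulate⁺ {P = q ℚ.≤_} (bound ∘ suc)))
  where
  others : List ℚ
  others = tabulate λ r → closeness (remove G (suc r))
  position : ∀ r → closeness (remove G r) ℚ.≤ q →
             closeness (remove G zero) ℚ.≤ q ⊎ Any (ℚ._≤ q) others
  position zero    ≤q = inj₁ ≤q
  position (suc r) ≤q = inj₂ (Any.tabulate⁺ {P = ℚ._≤ q} r ≤q)

-- Evaluation in closed form.

-- `fromℚᵘ (mkℚᵘ i d)` unfolds to `i / suc d`, so this and the next lemma compute with fractions
-- without handling their reduction to lowest terms.
fromℚᵘ-homo-+ : ∀ p q → ℚ.fromℚᵘ (p ℚᵘ.+ q) ≡ ℚ.fromℚᵘ p + ℚ.fromℚᵘ q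
fromℚᵘ-homo-+ p q = ℚ.toℚᵘ-injective (begin
  ℚ.toℚᵘ (ℚ.fromℚᵘ (p ℚᵘ.+ q))                      ≈⟨ ℚ.toℚᵘ-fromℚᵘ _ ⟩
  p ℚᵘ.+ q                                          ≈⟨ ℚᵘ.+-cong (ℚ.toℚᵘ-fromℚᵘ p) (ℚ.toℚᵘ-fromℚᵘ q) ⟨
  ℚ.toℚᵘ (ℚ.fromℚᵘ p) ℚᵘ.+ ℚ.toℚᵘ (ℚ.fromℚᵘ q)      ≈⟨ ℚ.toℚᵘ-homo-+ (ℚ.fromℚᵘ p) (ℚ.fromℚᵘ q) ⟨
  ℚ.toℚᵘ (ℚ.fromℚᵘ p + ℚ.fromℚᵘ q)                  ∎)
  where open SetoidReasoning ℚᵘ.≃-setoid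

fromℚᵘ-homo-* : ∀ p q → ℚ.fromℚᵘ (p ℚᵘ.* q) ≡ ℚ.fromℚᵘ p * ℚ.fromℚᵘ q
fromℚᵘ-homo-* p q = ℚ.toℚᵘ-injective (begin
  ℚ.toℚᵘ (ℚ.fromℚᵘ (p ℚᵘ.* q))                      ≈⟨ ℚ.toℚᵘ-fromℚᵘ _ ⟩
  p ℚᵘ.* q                                          ≈⟨ ℚᵘ.*-cong (ℚ.toℚᵘ-fromℚᵘ p) (ℚ.toℚᵘ-fromℚᵘ q) ⟨
  ℚ.toℚᵘ (ℚ.fromℚᵘ p) ℚᵘ.* ℚ.toℚᵘ (ℚ.fromℚᵘ q)      ≈⟨ ℚ.toℚᵘ-homo-* (ℚ.fromℚᵘ p) (ℚ.fromℚᵘ q) ⟨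
  ℚ.toℚᵘ (ℚ.fromℚᵘ p * ℚ.fromℚᵘ q)                  ∎)
  where open SetoidReasoning ℚᵘ.≃-setoid

suc/1 : ∀ k → + suc k / 1 ≡ 1ℚ + + k / 1
-- The unnormalised sum multiplies the numerator k by the other denominator, 1.
suc/1 k = trans (cong (λ i → (+ 1 ℤ.+ i) / 1) (sym (ℤ.*-identityʳ (+ k))))
  (fromℚᵘ-homo-+ (mkℚᵘ (+ 1) 0) (mkℚᵘ (+ k) 0))

product/2 : ∀ i j → (i ℤ.* j) / 2 ≡ (i / 1) * (j / 1) * ½
product/2 i j = begin
  (i ℤ.* j) / 2            ≡⟨ cong (_/ 2) (ℤ.*-identityʳ (i ℤ.* j)) ⟨
  (i ℤ.* j ℤ.* + 1) / 2    ≡⟨ fromℚᵘ-homo-* (mkℚᵘ (i ℤ.* j) 0) (mkℚᵘ (+ 1) 1) ⟩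
  ((i ℤ.* j) / 1) * ½      ≡⟨ cong (_* ½) (fromℚᵘ-homo-* (mkℚᵘ i 0) (mkℚᵘ j 0)) ⟩
  (i / 1) * (j / 1) * ½    ∎
  where open ≡-Reasoning

cliqueSum≡ : ∀ c → cliqueSum c ≡ (+ c / 1) * ½
cliqueSum≡ zero    = refl
cliqueSum≡ (suc c) rewrite cliqueSum≡ c | suc/1 c =
  solve 1 (λ x → x :* con ½ :+ con ½ := (con 1ℚ :+ x) :* con ½) refl (+ c / 1)

-- A clique on k + 1 vertices has (k + 1)k ordered pairs, each of weight ½.
cliqueTotal≡ : ∀ k → 2ℚ * cliqueTotal (suc k) ≡ (+ suc k / 1) * (+ k / 1) * ½
cliqueTotal≡ zero    = refl
cliqueTotal≡ (suc k) = begin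
  2ℚ * (cliqueTotal (suc k) + cliqueSum (suc k))
    ≡⟨ ℚ.*-distribˡ-+ 2ℚ (cliqueTotal (suc k)) (cliqueSum (suc k)) ⟩
  2ℚ * cliqueTotal (suc k) + 2ℚ * cliqueSum (suc k)
    ≡⟨ cong₂ (λ x y → x + 2ℚ * y) (cliqueTotal≡ k) (cliqueSum≡ (suc k)) ⟩
  (+ suc k / 1) * (+ k / 1) * ½ + 2ℚ * ((+ suc k / 1) * ½)
    ≡⟨ solve 2 (λ x y → y :* x :* con ½ :+ con 2ℚ :* (y :* con ½)
                        := (con 1ℚ :+ (con 1ℚ :+ x)) :* y :* con ½) refl (+ k / 1) (+ suc k / 1) ⟩
  (1ℚ + (1ℚ + + k / 1)) * (+ suc k / 1) * ½
    ≡⟨ cong (λ x → x * (+ suc k / 1) * ½) (trans (suc/1 (suc k)) (cong (λ x → 1ℚ + x) (suc/1 k))) ⟨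
  (+ suc (suc k) / 1) * (+ suc k / 1) * ½ ∎
  where
  open ≡-Reasoning

pathTotal≡ : ∀ n → 2ℚ * pathTotal n ≡ 2ℚ * (+ n / 1) + 4ℚ * ½^ n - 4ℚ
pathTotal≡ zero    = refl
pathTotal≡ (suc n) = begin
  2ℚ * (pathTotal n + (1ℚ - ½^ n))
    ≡⟨ ℚ.*-distribˡ-+ 2ℚ (pathTotal n) (1ℚ - ½^ n) ⟩
  2ℚ * pathTotal n + 2ℚ * (1ℚ - ½^ n)
    ≡⟨ cong (_+ 2ℚ * (1ℚ - ½^ n)) (pathTotal≡ n) ⟩
  2ℚ * (+ n / 1) + 4ℚ * ½^ n - 4ℚ + 2ℚ * (1ℚ - ½^ n)
    ≡⟨ solve 2 (λ x y → con 2ℚ :* x :+ con 4ℚ :* y :- con 4ℚ :+ con 2ℚ :* (con 1ℚ :- y)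
                        := con 2ℚ :* (con 1ℚ :+ x) :+ con 4ℚ :* (con ½ :* y) :- con 4ℚ)
         refl (+ n / 1) (½^ n) ⟩
  2ℚ * (1ℚ + + n / 1) + 4ℚ * (½ * ½^ n) - 4ℚ
    ≡⟨ cong (λ x → 2ℚ * x + 4ℚ * (½ * ½^ n) - 4ℚ) (suc/1 n) ⟨
  2ℚ * (+ suc n / 1) + 4ℚ * ½^ (suc n) - 4ℚ ∎
  where open ≡-Reasoning

-- The cases follow the sign of the exponent: `2^_` uses powers of 2 for n = 1, 2 and powers of ½
-- from n = 3 on.
2^[2-n] : ∀ {n} → 1 ≤ n → 2^ (+ 2 ℤ.- + n) ≡ 4ℚ * ½^ n
2^[2-n] {1} _ = refl
2^[2-n] {2} _ = refl
2^[2-n] {suc (suc (suc n))} _ = solve 1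
  (λ x → con ½ :* x := con 4ℚ :* (con ½ :* (con ½ :* (con ½ :* x)))) refl (½^ n)

total≡ : ∀ k {n} → 1 ≤ n →
  total (suc k) n ≡ (+ suc k ℤ.* + k) / 2 + 2ℚ * (+ n / 1) + 2^ (+ 2 ℤ.- + n) - 4ℚ
total≡ k {n} 1≤n = begin
  2ℚ * (cliqueTotal (suc k) + pathTotal n)
    ≡⟨ ℚ.*-distribˡ-+ 2ℚ (cliqueTotal (suc k)) (pathTotal n) ⟩
  2ℚ * cliqueTotal (suc k) + 2ℚ * pathTotal n
    ≡⟨ cong₂ _+_ (trans (cliqueTotal≡ k) (sym (product/2 (+ suc k) (+ k)))) (pathTotal≡ n) ⟩
  P + (2ℚ * (+ n / 1) + 4ℚ * ½^ n - 4ℚ)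
    ≡⟨ solve 3 (λ p x y → p :+ (x :+ y :- con 4ℚ) := p :+ x :+ y :- con 4ℚ) refl
         P (2ℚ * (+ n / 1)) (4ℚ * ½^ n) ⟩
  P + 2ℚ * (+ n / 1) + 4ℚ * ½^ n - 4ℚ
    ≡⟨ cong (λ x → P + 2ℚ * (+ n / 1) + x - 4ℚ) (2^[2-n] 1≤n) ⟨
  P + 2ℚ * (+ n / 1) + 2^ (+ 2 ℤ.- + n) - 4ℚ ∎
  where
  open ≡-Reasoning
  P = (+ suc k ℤ.* + k) / 2

theorem2 : (m n : ℕ) (3≤m : 3 ≤ m) (1≤n : 1 ≤ n) →
    vertexResidualCloseness (lollipop m n) {{lollipop-nonempty m n 3≤m}}
    ≡ ((+ m ℤ.- + 1) ℤ.* (+ m ℤ.- + 2)) / 2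
    + (+ 2 / 1) * (+ n / 1)
    + 2^ (+ 2 ℤ.- + n)
    - (+ 4 / 1)
theorem2 (suc (suc k)) n (s≤s 2≤m) 1≤n =
  trans (vertexResidualCloseness≡ (lollipop (suc (suc k)) n) {total (suc k) n} bridgehead
          (remove-bridge≤ (suc k) n bridgehead 1≤n (Fin.toℕ-fromℕ< inRange))
          (λ r → remove≥ (suc k) n r 2≤m 1≤n))
        (total≡ k 1≤n)
  where
  inRange : suc k < suc (suc k) ℕ.+ n
  inRange = ℕ.m≤m+n (suc (suc k)) n

  -- Labels start at 1, so the vertex labelled m has index m - 1 = k + 1.
  bridgehead : Fin (suc (suc k) ℕ.+ n)
  bridgehead = fromℕ< inRange
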